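{- For all positive integers $m_1,\dots,m_S$, $$B(m_1,\dots,m_S)=\sum_{\ell_1=0}^{m_1-1}\cdots\sum_{\ell_S=0}^{m_S-1}\frac{(\ell_1+\dots+\ell_S)!}{\ell_1!\cdots\ell_S!}.$$
   Context: For nonnegative integers $n_1,\dots,n_S$, $E(n_1,\dots,n_S)$ denotes the number of block derangements: $S$ players hold $n_1,\dots,n_S$ distinct cards respectively; all $N=n_1+\dots+n_S$ cards are redealt so that player $j$ again receives exactly $n_j$ cards (only which cards each player gets matters); $E$ counts the deals in which no player receives any card he originally held. Equivalently, $E(n_1,\dots,n_S)$ is the coefficient of $x_1^{n_1}\cdots x_S^{n_S}$ in $\prod_{j=1}^S(x_1+\dots+x_S-x_j)^{n_j}$. By convention $E(0,\dots,0)=1$. For positive integers $m_1,\dots,m_S$, $B(m_1,\dots,m_S)=\sum_{k_1=1}^{m_1}\cdots\sum_{k_S=1}^{m_S}\binom{m_1}{k_1}\cdots\binom{m_S}{k_S}E(k_1-1,\dots,k_S-1)$. -}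

module Defs where

open import Data.Fin using (Fin; zero; suc; _≟_)
open import Data.Fin.Properties using (all?)
open import Data.List as List using (List; cartesianProductWith; filter; length; allFin; upTo)
open import Data.List.Membership.Propositional using (_∈_)
open import Data.List.Membership.Propositional.Properties
  using (∈-cartesianProductWith⁺; ∈-allFin)
open import Data.List.Relation.Unary.Any using (here)
open import Data.List.Relation.Unary.All using ([])
open import Data.List.Relation.Unary.AllPairs using ([]; _∷_)
open import Data.List.Relation.Unary.Unique.Propositional using (Unique)
open import Data.List.Relation.Unary.Unique.Propositional.Properties
  using (cartesianProductWith⁺; allFin⁺)
open import Data.Nat as ℕ using (ℕ; suc; pred; NonZero; _+_; _*_; _/_; _!)
open import Data.Nat.Combinatorics using (_C_)
open import Data.Nat.Combinatorics.Specification using ([n∸k]!k!∣n!)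
open import Data.Nat.Divisibility using (_∣_; ∣-refl; ∣-trans; *-monoʳ-∣)
open import Data.Nat.ListAction using (sum)
open import Data.Nat.Properties using (_!≢0; m*n≢0; m≤m+n; m+n∸m≡n; *-comm)
open import Data.Product using (_×_)
open import Data.Vec as Vec using (Vec; []; _∷_; _++_; count; lookup; replicate; foldr′; zipWith)
open import Data.Vec.Properties using (∷-injective)
open import Data.Vec.Relation.Binary.Pointwise.Inductive as Pointwise using (Pointwise)
open import Relation.Binary.PropositionalEquality using (_≡_; _≢_; refl; cong; trans; subst)
open import Relation.Nullary using (Dec; ¬?; _×-dec_)

tuples : ∀ {a} {A : Set a} {n} → Vec (List A) n → List (Vec A n)
tuples []         = List.[ [] ]
tuples (xs ∷ xss) = cartesianProductWith _∷_ xs (tuples xss)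

-- The iterated sum over t₁ ∈ r₁, …, tₛ ∈ rₛ of f (t₁ , … , tₛ).
Σ-over : ∀ {S} → Vec (List ℕ) S → (Vec ℕ S → ℕ) → ℕ
Σ-over r f = sum (List.map f (tuples r))

prod : ∀ {S} → Vec ℕ S → ℕ
prod = foldr′ _*_ 1

-- The N = n₁ + … + nₛ distinct cards are the positions 0, …, N - 1 of a
-- vector, grouped by player: the entry at a position is the original holder.
owners : ∀ {S} (n : Vec ℕ S) → Vec (Fin S) (Vec.sum n)
owners []       = []
owners (n ∷ ns) = replicate n zero ++ Vec.map suc (owners ns)

-- An assignment gives the new holder of each card, so the order in which a
-- player receives cards is disregarded.
assignments : ∀ S N → List (Vec (Fin S) N)
assignments S N = tuples (replicate N (allFin S))

assignments-complete : ∀ {S N} (d : Vec (Fin S) N) → d ∈ assignments S N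
assignments-complete []      = here refl
assignments-complete (j ∷ d) =
  ∈-cartesianProductWith⁺ _∷_ (∈-allFin j) (assignments-complete d)

assignments-unique : ∀ S N → Unique (assignments S N)
assignments-unique S ℕ.zero  = [] ∷ []
assignments-unique S (suc N) =
  cartesianProductWith⁺ _∷_ ∷-injective (allFin⁺ S) (assignments-unique S N)

IsDeal : ∀ {S} (n : Vec ℕ S) → Vec (Fin S) (Vec.sum n) → Set
IsDeal n d = ∀ j → count (_≟ j) d ≡ lookup n j

IsBlockDerangement : ∀ {S} (n : Vec ℕ S) → Vec (Fin S) (Vec.sum n) → Set
IsBlockDerangement n d = IsDeal n d × Pointwise _≢_ (owners n) d

isBlockDerangement? : ∀ {S} (n : Vec ℕ S) d → Dec (IsBlockDerangement n d)
isBlockDerangement? n d =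
  all? (λ j → count (_≟ j) d ℕ.≟ lookup n j)
    ×-dec Pointwise.decidable (λ i j → ¬? (i ≟ j)) (owners n) d

-- E (0 , … , 0) = 1 needs no separate clause: with no cards there is exactly
-- one assignment, and it is a block derangement.
E : ∀ {S} → Vec ℕ S → ℕ
E {S} n = length (filter (isBlockDerangement? n) (assignments S (Vec.sum n)))

-- pred is only applied to entries kⱼ ≥ 1 here.
B : ∀ {S} → Vec ℕ S → ℕ
B m = Σ-over (Vec.map (λ mⱼ → List.map suc (upTo mⱼ)) m)
             (λ k → prod (zipWith _C_ m k) * E (Vec.map pred k))

prod!≢0 : ∀ {S} (l : Vec ℕ S) → NonZero (prod (Vec.map _! l))
prod!≢0 []       = _
prod!≢0 (l ∷ ls) = m*n≢0 (l !) _ {{l !≢0}} {{prod!≢0 ls}}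

-- The division is exact, by prod!∣sum!.
multinomial : ∀ {S} → Vec ℕ S → ℕ
multinomial l = (Vec.sum l ! / prod (Vec.map _! l)) {{prod!≢0 l}}

prod!∣sum! : ∀ {S} (l : Vec ℕ S) → prod (Vec.map _! l) ∣ Vec.sum l !
prod!∣sum! []       = ∣-refl
prod!∣sum! (l ∷ ls) = ∣-trans (*-monoʳ-∣ (l !) (prod!∣sum! ls))
  (subst (_∣ (l + s) !)
    (trans (cong (λ t → t ! * l !) (m+n∸m≡n l s)) (*-comm (s !) (l !)))
    ([n∸k]!k!∣n! (m≤m+n l s)))
  where s = Vec.sum ls

{-# OPTIONS --safe #-}
module Submission where

-- There are multinomial l deals altogether. Sorting them by the number lⱼ - kⱼ
-- of own cards that each player j gets back, and removing these cards, gives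
-- multinomial l = Σ_{k ≤ l} (∏ⱼ lⱼ C kⱼ) E k. Summing over all l with lⱼ < mⱼ,
-- the hockey-stick identity Σ_{l < m} l C k = m C (k + 1) in each coordinate
-- turns the coefficient of E k into ∏ⱼ mⱼ C (kⱼ + 1), which is B m.

open import Defs
open import Data.Bool using (true; false; if_then_else_)
open import Data.Fin using (Fin; zero; suc; _≟_)
open import Data.List as List using (List; []; _∷_; _∷ʳ_; allFin; filter; length; upTo)
open import Data.List.Membership.Propositional using (_∈_)
open import Data.List.Membership.Propositional.Properties using (∈-upTo⁻)
open import Data.List.Properties as List
  using (map-cong; map-cong-local; upTo-∷ʳ; filter-++; filter-none; filter-≐; length-++)
import Data.List.Relation.Unary.All as ListAll
open import Data.Nat as ℕ using (ℕ; zero; suc; pred; _+_; _*_; _∸_; _<_; _≤_; s≤s⁻¹; _!)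
open import Data.Nat.Combinatorics using (_C_; nCk+nC[k+1]≡[n+1]C[k+1]; k>n⇒nCk≡0)
open import Data.Nat.DivMod using (m*n/n≡m)
open import Data.Nat.ListAction using (sum)
open import Data.Nat.ListAction.Properties using (sum-++)
open import Data.Nat.Properties
  using (*-assoc; *-comm; *-distribʳ-+; *-distribˡ-+; *-zeroʳ; +-∸-assoc; +-assoc;
         +-cancelʳ-≡; +-comm; +-identityʳ; +-identityˡ; +-monoʳ-<; +-suc; <-irrefl;
         <-≤-trans; m+[n∸m]≡n; m≤m+n; n<1+n; suc-injective)
open import Data.Nat.Solver using (module +-*-Solver)
open import Data.Product using (∃; _×_; _,_; proj₁; proj₂)
open import Data.Sum using (_⊎_; inj₁; inj₂; [_,_]′)
open import Data.Vec as Vec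
  using (Vec; []; _∷_; _++_; count; lookup; map; replicate; zipWith; _[_]≔_)
open import Data.Vec.Properties
  using (≡-dec; zipWith-comm; zipWith-assoc; zipWith-identityˡ; zipWith-identityʳ;
         lookup-zipWith; lookup-replicate; map-++; map-replicate; map-∘; map-id; ∷-injective)
open import Data.Vec.Relation.Binary.Pointwise.Inductive as Pointwise using (Pointwise; []; _∷_)
open import Data.Vec.Relation.Unary.All using (All)
open import Function using (_∘_; id)
open import Relation.Binary.PropositionalEquality
open import Relation.Nullary using (Dec; yes; no; does; ¬?; _×-dec_; contradiction; toSum)
open import Relation.Unary using (Decidable)

open ≡-Reasoning

private variable
  X Y : Set
  S N : ℕ

-- Finite sums

∑ : List X → (X → ℕ) → ℕ
∑ xs f = sum (List.map f xs)

syntax ∑ xs (λ x → e) = ∑[ x ← xs ] e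

∑-cong : ∀ (xs : List X) {f g : X → ℕ} → (∀ x → f x ≡ g x) → ∑ xs f ≡ ∑ xs g
∑-cong xs f≗g = cong sum (map-cong f≗g xs)

∑-cong-∈ : ∀ (xs : List X) {f g : X → ℕ} → (∀ {x} → x ∈ xs → f x ≡ g x) → ∑ xs f ≡ ∑ xs g
∑-cong-∈ xs f≗g = cong sum (map-cong-local (ListAll.tabulate f≗g))

∑-+ : ∀ (xs : List X) (f g : X → ℕ) → ∑[ x ← xs ] (f x + g x) ≡ ∑ xs f + ∑ xs g
∑-+ []       f g = refl
∑-+ (x ∷ xs) f g rewrite ∑-+ xs f g =
  solve 4 (λ a b c d → (a :+ b) :+ (c :+ d) := (a :+ c) :+ (b :+ d)) refl
    (f x) (g x) (∑ xs f) (∑ xs g)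
  where open +-*-Solver

∑-*ˡ : ∀ (xs : List X) c (f : X → ℕ) → c * ∑ xs f ≡ ∑[ x ← xs ] (c * f x)
∑-*ˡ []       c f = *-zeroʳ c
∑-*ˡ (x ∷ xs) c f = trans (*-distribˡ-+ c (f x) _) (cong (c * f x +_) (∑-*ˡ xs c f))

∑-*ʳ : ∀ (xs : List X) c (f : X → ℕ) → ∑ xs f * c ≡ ∑[ x ← xs ] (f x * c)
∑-*ʳ xs c f = begin
  ∑ xs f * c            ≡⟨ *-comm _ c ⟩
  c * ∑ xs f            ≡⟨ ∑-*ˡ xs c f ⟩
  ∑[ x ← xs ] (c * f x) ≡⟨ ∑-cong xs (λ x → *-comm c (f x)) ⟩
  ∑[ x ← xs ] (f x * c) ∎

∑-zero : ∀ (xs : List X) → ∑[ x ← xs ] 0 ≡ 0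
∑-zero []       = refl
∑-zero (x ∷ xs) = ∑-zero xs

∑-swap : ∀ (xs : List X) (ys : List Y) (f : X → Y → ℕ) →
  ∑[ x ← xs ] ∑[ y ← ys ] f x y ≡ ∑[ y ← ys ] ∑[ x ← xs ] f x y
∑-swap []       ys f = sym (∑-zero ys)
∑-swap (x ∷ xs) ys f =
  trans (cong (∑ ys (f x) +_) (∑-swap xs ys f)) (sym (∑-+ ys (f x) _))

a*[b*c]≡b*[a*c] : ∀ a b c → a * (b * c) ≡ b * (a * c)
a*[b*c]≡b*[a*c] = solve 3 (λ a b c → a :* (b :* c) := b :* (a :* c)) refl
  where open +-*-Solver

-- Interchanges the choice of a receiver, weighted by `χ`, with the index of a binomial expansion,
-- weighted by binomial coefficients.
∑-swap-weighted : ∀ (xs : List X) (ys : List Y) (a : X → ℕ) (b : Y → ℕ) (f : X → Y → ℕ) →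
  ∑[ x ← xs ] (a x * ∑[ y ← ys ] (b y * f x y)) ≡ ∑[ y ← ys ] (b y * ∑[ x ← xs ] (a x * f x y))
∑-swap-weighted xs ys a b f = begin
  ∑[ x ← xs ] (a x * ∑[ y ← ys ] (b y * f x y))
    ≡⟨ ∑-cong xs (λ x → ∑-*ˡ ys (a x) _) ⟩
  ∑[ x ← xs ] ∑[ y ← ys ] (a x * (b y * f x y))
    ≡⟨ ∑-swap xs ys _ ⟩
  ∑[ y ← ys ] ∑[ x ← xs ] (a x * (b y * f x y))
    ≡⟨ ∑-cong ys (λ y → ∑-cong xs λ x → a*[b*c]≡b*[a*c] (a x) (b y) (f x y)) ⟩
  ∑[ y ← ys ] ∑[ x ← xs ] (b y * (a x * f x y))
    ≡⟨ ∑-cong ys (λ y → ∑-*ˡ xs (b y) _) ⟨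
  ∑[ y ← ys ] (b y * ∑[ x ← xs ] (a x * f x y)) ∎

∑-++ : ∀ (xs ys : List X) (f : X → ℕ) → ∑ (xs List.++ ys) f ≡ ∑ xs f + ∑ ys f
∑-++ xs ys f = trans (cong sum (List.map-++ f xs ys)) (sum-++ (List.map f xs) _)

∑-map : ∀ (h : X → Y) xs (f : Y → ℕ) → ∑ (List.map h xs) f ≡ ∑ xs (f ∘ h)
∑-map h xs f = cong sum (sym (List.map-∘ xs))

∑-upTo-head : ∀ n (f : ℕ → ℕ) → ∑ (upTo (suc n)) f ≡ f 0 + ∑ (upTo n) (f ∘ suc)
∑-upTo-head n f = cong (λ l → f 0 + sum l)
  (trans (List.map-applyUpTo suc f n) (sym (List.map-upTo (f ∘ suc) n)))

∑-upTo-last : ∀ n (f : ℕ → ℕ) → ∑ (upTo (suc n)) f ≡ ∑ (upTo n) f + f n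
∑-upTo-last n f = begin
  ∑ (upTo (suc n)) f           ≡⟨ cong (λ l → ∑ l f) (upTo-∷ʳ n) ⟨
  ∑ (upTo n ∷ʳ n) f            ≡⟨ ∑-++ (upTo n) List.[ n ] f ⟩
  ∑ (upTo n) f + (f n + 0)     ≡⟨ cong (∑ (upTo n) f +_) (+-identityʳ (f n)) ⟩
  ∑ (upTo n) f + f n           ∎

∑-allFin-suc : ∀ S (f : Fin (suc S) → ℕ) → ∑ (allFin (suc S)) f ≡ f zero + ∑ (allFin S) (f ∘ suc)
∑-allFin-suc S f = cong (λ l → f zero + sum l)
  (trans (List.map-tabulate suc f) (sym (List.map-tabulate id (f ∘ suc))))

∑-cartesianProductWith : ∀ {Z : Set} (h : X → Y → Z) xs ys (f : Z → ℕ) →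
  ∑ (List.cartesianProductWith h xs ys) f ≡ ∑[ x ← xs ] ∑[ y ← ys ] f (h x y)
∑-cartesianProductWith h []       ys f = refl
∑-cartesianProductWith h (x ∷ xs) ys f =
  trans (∑-++ (List.map (h x) ys) _ f)
    (cong₂ _+_ (∑-map (h x) ys f) (∑-cartesianProductWith h xs ys f))

Σ-over-∷ : ∀ xs (r : Vec (List ℕ) S) (f : Vec ℕ (suc S) → ℕ) →
  Σ-over (xs ∷ r) f ≡ ∑[ x ← xs ] Σ-over r (λ t → f (x ∷ t))
Σ-over-∷ xs r = ∑-cartesianProductWith _∷_ xs (tuples r)

-- With `h = suc` this moves the ranges 1, ..., mⱼ of `B` to 0, ..., mⱼ - 1.
Σ-over-map : ∀ (h : ℕ → ℕ) (r : Vec (List ℕ) S) (f : Vec ℕ S → ℕ) →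
  Σ-over (map (List.map h) r) f ≡ Σ-over r (f ∘ map h)
Σ-over-map h []       f = refl
Σ-over-map h (xs ∷ r) f = begin
  Σ-over (List.map h xs ∷ map (List.map h) r) f
    ≡⟨ Σ-over-∷ (List.map h xs) (map (List.map h) r) f ⟩
  ∑[ x ← List.map h xs ] Σ-over (map (List.map h) r) (λ t → f (x ∷ t))
    ≡⟨ ∑-map h xs _ ⟩
  ∑[ x ← xs ] Σ-over (map (List.map h) r) (λ t → f (h x ∷ t))
    ≡⟨ ∑-cong xs (λ x → Σ-over-map h r _) ⟩
  ∑[ x ← xs ] Σ-over r (λ t → f (h x ∷ map h t))
    ≡⟨ Σ-over-∷ xs r _ ⟨
  Σ-over (xs ∷ r) (f ∘ map h) ∎

Σ≤ : Vec ℕ S → (Vec ℕ S → ℕ) → ℕ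
Σ≤ n = Σ-over (map (upTo ∘ suc) n)

Σ≤-∷ : ∀ n (ns : Vec ℕ S) (f : Vec ℕ (suc S) → ℕ) →
  Σ≤ (n ∷ ns) f ≡ ∑[ k ← upTo (suc n) ] Σ≤ ns (λ ks → f (k ∷ ks))
Σ≤-∷ n ns = Σ-over-∷ (upTo (suc n)) (map (upTo ∘ suc) ns)

-- The bound on `k` is passed to the summands because `n ∸ k` is a true difference only under it.
Σ≤-cong : ∀ (n : Vec ℕ S) {f g : Vec ℕ S → ℕ} →
  (∀ {k} → Pointwise _≤_ k n → f k ≡ g k) → Σ≤ n f ≡ Σ≤ n g
Σ≤-cong []       f≗g = cong (_+ 0) (f≗g [])
Σ≤-cong (n ∷ ns) {f} {g} f≗g = begin
  Σ≤ (n ∷ ns) f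
    ≡⟨ Σ≤-∷ n ns f ⟩
  ∑[ k ← upTo (suc n) ] Σ≤ ns (λ ks → f (k ∷ ks))
    ≡⟨ ∑-cong-∈ (upTo (suc n)) (λ k∈ → Σ≤-cong ns λ ks≤ns → f≗g (s≤s⁻¹ (∈-upTo⁻ k∈) ∷ ks≤ns)) ⟩
  ∑[ k ← upTo (suc n) ] Σ≤ ns (λ ks → g (k ∷ ks))
    ≡⟨ Σ≤-∷ n ns g ⟨
  Σ≤ (n ∷ ns) g ∎

-- Binomial coefficients

-- Pascal's rule under a sum: the induction step of the binomial theorem for 1 plus the shift of
-- `g`.
∑-pascal : ∀ n (g : ℕ → ℕ) →
  ∑[ k ← upTo (suc (suc n)) ] ((suc n C k) * g k)
    ≡ ∑[ k ← upTo (suc n) ] ((n C k) * (g k + g (suc k)))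
∑-pascal n g = begin
  ∑[ k ← upTo (suc (suc n)) ] ((suc n C k) * g k)
    ≡⟨ ∑-upTo-head (suc n) (λ k → (suc n C k) * g k) ⟩
  (suc n C 0) * g 0 + ∑[ k ← upTo (suc n) ] ((suc n C suc k) * g (suc k))
    -- The head coefficient changes silently: `suc n C 0` and `n C 0` agree by computation.
    ≡⟨ cong ((suc n C 0) * g 0 +_) (∑-cong (upTo (suc n)) split) ⟩
  (n C 0) * g 0 + ∑[ k ← upTo (suc n) ] ((n C suc k) * g (suc k) + (n C k) * g (suc k))
    ≡⟨ cong ((n C 0) * g 0 +_) (∑-+ (upTo (suc n))
         (λ k → (n C suc k) * g (suc k)) (λ k → (n C k) * g (suc k))) ⟩
  (n C 0) * g 0 + (∑[ k ← upTo (suc n) ] ((n C suc k) * g (suc k)) + R)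
    ≡⟨ +-assoc ((n C 0) * g 0) _ R ⟨
  (n C 0) * g 0 + ∑[ k ← upTo (suc n) ] ((n C suc k) * g (suc k)) + R
    ≡⟨ cong (_+ R) (∑-upTo-head (suc n) (λ k → (n C k) * g k)) ⟨
  ∑[ k ← upTo (suc (suc n)) ] ((n C k) * g k) + R
    ≡⟨ cong (_+ R) (∑-upTo-last (suc n) (λ k → (n C k) * g k)) ⟩
  L + (n C suc n) * g (suc n) + R
    -- The term k = n + 1, gained by restoring the head, has coefficient 0.
    ≡⟨ cong (λ c → L + c * g (suc n) + R) (k>n⇒nCk≡0 (n<1+n n)) ⟩
  L + 0 + R
    ≡⟨ cong (_+ R) (+-identityʳ L) ⟩
  L + R
    ≡⟨ ∑-+ (upTo (suc n)) (λ k → (n C k) * g k) (λ k → (n C k) * g (suc k)) ⟨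
  ∑[ k ← upTo (suc n) ] ((n C k) * g k + (n C k) * g (suc k))
    ≡⟨ ∑-cong (upTo (suc n)) (λ k → *-distribˡ-+ (n C k) (g k) (g (suc k))) ⟨
  ∑[ k ← upTo (suc n) ] ((n C k) * (g k + g (suc k))) ∎
  where
  L R : ℕ
  L = ∑[ k ← upTo (suc n) ] ((n C k) * g k)
  R = ∑[ k ← upTo (suc n) ] ((n C k) * g (suc k))

  split : ∀ k → (suc n C suc k) * g (suc k) ≡ (n C suc k) * g (suc k) + (n C k) * g (suc k)
  split k = begin
    (suc n C suc k) * g (suc k)                   ≡⟨ cong (_* g (suc k)) (nCk+nC[k+1]≡[n+1]C[k+1] n k) ⟨
    ((n C k) + (n C suc k)) * g (suc k)           ≡⟨ cong (_* g (suc k)) (+-comm (n C k) (n C suc k)) ⟩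
    ((n C suc k) + (n C k)) * g (suc k)           ≡⟨ *-distribʳ-+ (g (suc k)) (n C suc k) (n C k) ⟩
    (n C suc k) * g (suc k) + (n C k) * g (suc k) ∎

-- Induction on `m`: the new row l = m adds m C k to m C (k + 1), which is Pascal's rule. The weight
-- `g` leaves room for the sum over the other coordinates.
hockey-stick : ∀ m (g : ℕ → ℕ) →
  ∑[ l ← upTo m ] ∑[ k ← upTo (suc l) ] ((l C k) * g k) ≡ ∑[ k ← upTo m ] ((m C suc k) * g k)
hockey-stick zero    g = refl
hockey-stick (suc m) g = begin
  ∑[ l ← upTo (suc m) ] ∑[ k ← upTo (suc l) ] ((l C k) * g k)
    ≡⟨ ∑-upTo-last m (λ l → ∑[ k ← upTo (suc l) ] ((l C k) * g k)) ⟩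
  ∑[ l ← upTo m ] ∑[ k ← upTo (suc l) ] ((l C k) * g k) + L
    ≡⟨ cong (_+ L) (hockey-stick m g) ⟩
  R + L
    ≡⟨ +-comm R L ⟩
  L + R
    ≡⟨ cong (L +_) (+-identityʳ R) ⟨
  L + (R + 0)
    -- A zero term for k = m is inserted so that `R` has the same range as `L`.
    ≡⟨ cong (λ c → L + (R + c * g m)) (k>n⇒nCk≡0 (n<1+n m)) ⟨
  L + (R + (m C suc m) * g m)
    ≡⟨ cong (L +_) (∑-upTo-last m (λ k → (m C suc k) * g k)) ⟨
  L + ∑[ k ← upTo (suc m) ] ((m C suc k) * g k)
    ≡⟨ ∑-+ (upTo (suc m)) (λ k → (m C k) * g k) (λ k → (m C suc k) * g k) ⟨
  ∑[ k ← upTo (suc m) ] ((m C k) * g k + (m C suc k) * g k)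
    ≡⟨ ∑-cong (upTo (suc m)) (λ k → *-distribʳ-+ (g k) (m C k) (m C suc k)) ⟨
  ∑[ k ← upTo (suc m) ] (((m C k) + (m C suc k)) * g k)
    ≡⟨ ∑-cong (upTo (suc m)) (λ k → cong (_* g k) (nCk+nC[k+1]≡[n+1]C[k+1] m k)) ⟩
  ∑[ k ← upTo (suc m) ] ((suc m C suc k) * g k) ∎
  where
  L R : ℕ
  L = ∑[ k ← upTo (suc m) ] ((m C k) * g k)
  R = ∑[ k ← upTo m ] ((m C suc k) * g k)

∏C : Vec ℕ S → Vec ℕ S → ℕ
∏C n k = prod (zipWith _C_ n k)

-- The map `h` is `id` for the coefficients in `Σ≤` and `suc` for those in `B`, so one lemma serves
-- both.
Σ-over-∏C-∷ : ∀ n (ns : Vec ℕ S) (h : ℕ → ℕ) (xs : List ℕ) r (f : Vec ℕ (suc S) → ℕ) →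
  Σ-over (xs ∷ r) (λ k → ∏C (n ∷ ns) (map h k) * f k)
    ≡ ∑[ k ← xs ] ((n C h k) * Σ-over r (λ ks → ∏C ns (map h ks) * f (k ∷ ks)))
Σ-over-∏C-∷ n ns h xs r f = begin
  Σ-over (xs ∷ r) (λ k → ∏C (n ∷ ns) (map h k) * f k)
    ≡⟨ Σ-over-∷ xs r _ ⟩
  ∑[ k ← xs ] Σ-over r (λ ks → (n C h k) * ∏C ns (map h ks) * f (k ∷ ks))
    ≡⟨ ∑-cong xs (λ k → ∑-cong (tuples r) λ ks → *-assoc (n C h k) _ _) ⟩
  ∑[ k ← xs ] Σ-over r (λ ks → (n C h k) * (∏C ns (map h ks) * f (k ∷ ks)))
    ≡⟨ ∑-cong xs (λ k → ∑-*ˡ (tuples r) (n C h k) _) ⟨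
  ∑[ k ← xs ] ((n C h k) * Σ-over r (λ ks → ∏C ns (map h ks) * f (k ∷ ks))) ∎

Σ≤-∏C-∷ : ∀ n (ns : Vec ℕ S) (f : Vec ℕ (suc S) → ℕ) →
  Σ≤ (n ∷ ns) (λ k → ∏C (n ∷ ns) k * f k)
    ≡ ∑[ k ← upTo (suc n) ] ((n C k) * Σ≤ ns (λ ks → ∏C ns ks * f (k ∷ ks)))
Σ≤-∏C-∷ n ns f = begin
  Σ≤ (n ∷ ns) (λ k → ∏C (n ∷ ns) k * f k)
    ≡⟨ ∑-cong (tuples (map (upTo ∘ suc) (n ∷ ns)))
         (λ k → cong (λ k′ → ∏C (n ∷ ns) k′ * f k) (map-id k)) ⟨
  Σ≤ (n ∷ ns) (λ k → ∏C (n ∷ ns) (map id k) * f k)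
    ≡⟨ Σ-over-∏C-∷ n ns id (upTo (suc n)) (map (upTo ∘ suc) ns) f ⟩
  ∑[ k ← upTo (suc n) ] ((n C k) * Σ≤ ns (λ ks → ∏C ns (map id ks) * f (k ∷ ks)))
    ≡⟨ ∑-cong (upTo (suc n)) (λ k → cong ((n C k) *_) (∑-cong (tuples (map (upTo ∘ suc) ns))
         λ ks → cong (λ k′ → ∏C ns k′ * f (k ∷ ks)) (map-id ks))) ⟩
  ∑[ k ← upTo (suc n) ] ((n C k) * Σ≤ ns (λ ks → ∏C ns ks * f (k ∷ ks))) ∎

∏-hockey-stick : ∀ (m : Vec ℕ S) (g : Vec ℕ S → ℕ) →
  Σ-over (map upTo m) (λ l → Σ≤ l (λ k → ∏C l k * g k))
    ≡ Σ-over (map upTo m) (λ k → ∏C m (map suc k) * g k)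
∏-hockey-stick []       g = +-identityʳ _
∏-hockey-stick (m ∷ ms) g = begin
  Σ-over (upTo m ∷ map upTo ms) (λ l → Σ≤ l (λ k → ∏C l k * g k))
    ≡⟨ Σ-over-∷ (upTo m) (map upTo ms) _ ⟩
  ∑[ l ← upTo m ] ∑[ ls ← tuples (map upTo ms) ] Σ≤ (l ∷ ls) (λ k → ∏C (l ∷ ls) k * g k)
    ≡⟨ ∑-cong (upTo m) (λ l → ∑-cong (tuples (map upTo ms)) λ ls → Σ≤-∏C-∷ l ls g) ⟩
  ∑[ l ← upTo m ] ∑[ ls ← tuples (map upTo ms) ] ∑[ k ← upTo (suc l) ] ((l C k) * G k ls)
    -- With `k` outside `ls`, everything about the other coordinates becomes a weight depending on
    -- `k` alone, as `hockey-stick` requires.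
    ≡⟨ ∑-cong (upTo m) (λ l → ∑-swap (tuples (map upTo ms)) (upTo (suc l)) _) ⟩
  ∑[ l ← upTo m ] ∑[ k ← upTo (suc l) ] ∑[ ls ← tuples (map upTo ms) ] ((l C k) * G k ls)
    ≡⟨ ∑-cong (upTo m) (λ l → ∑-cong (upTo (suc l)) λ k → ∑-*ˡ (tuples (map upTo ms)) (l C k) (G k)) ⟨
  ∑[ l ← upTo m ] ∑[ k ← upTo (suc l) ] ((l C k) * Σ-over (map upTo ms) (G k))
    ≡⟨ hockey-stick m (λ k → Σ-over (map upTo ms) (G k)) ⟩
  ∑[ k ← upTo m ] ((m C suc k) * Σ-over (map upTo ms) (G k))
    ≡⟨ ∑-cong (upTo m) (λ k → cong ((m C suc k) *_) (∏-hockey-stick ms (λ ks → g (k ∷ ks)))) ⟩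
  ∑[ k ← upTo m ] ((m C suc k) * Σ-over (map upTo ms) (λ ks → ∏C ms (map suc ks) * g (k ∷ ks)))
    ≡⟨ Σ-over-∏C-∷ m ms suc (upTo m) (map upTo ms) g ⟨
  Σ-over (upTo m ∷ map upTo ms) (λ k → ∏C (m ∷ ms) (map suc k) * g k) ∎
  where
  G : ℕ → Vec ℕ _ → ℕ
  G k ls = Σ≤ ls (λ ks → ∏C ls ks * g (k ∷ ks))

-- Vectors of card counts

infixl 6 _⊕_

_⊕_ : Vec ℕ S → Vec ℕ S → Vec ℕ S
_⊕_ = zipWith _+_

𝟎 : Vec ℕ S
𝟎 = replicate _ 0

single : Fin S → ℕ → Vec ℕ S
single i a = 𝟎 [ i ]≔ a

⊕-comm : ∀ (u v : Vec ℕ S) → u ⊕ v ≡ v ⊕ u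
⊕-comm = zipWith-comm +-comm

⊕-assoc : ∀ (u v w : Vec ℕ S) → u ⊕ v ⊕ w ≡ u ⊕ (v ⊕ w)
⊕-assoc = zipWith-assoc +-assoc

⊕-identityˡ : ∀ (u : Vec ℕ S) → 𝟎 ⊕ u ≡ u
⊕-identityˡ = zipWith-identityˡ +-identityˡ

⊕-identityʳ : ∀ (u : Vec ℕ S) → u ⊕ 𝟎 ≡ u
⊕-identityʳ = zipWith-identityʳ +-identityʳ

⊕-right-comm : ∀ (u v w : Vec ℕ S) → u ⊕ v ⊕ w ≡ u ⊕ w ⊕ v
⊕-right-comm u v w =
  trans (⊕-assoc u v w) (trans (cong (u ⊕_) (⊕-comm v w)) (sym (⊕-assoc u w v)))

⊕-cancelʳ : ∀ (u v w : Vec ℕ S) → v ⊕ u ≡ w ⊕ u → v ≡ w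
⊕-cancelʳ []       []       []       _  = refl
⊕-cancelʳ (x ∷ u) (y ∷ v) (z ∷ w) eq =
  cong₂ _∷_ (+-cancelʳ-≡ x y z (proj₁ (∷-injective eq))) (⊕-cancelʳ u v w (proj₂ (∷-injective eq)))

⊕-∸ : ∀ {k n : Vec ℕ S} → Pointwise _≤_ k n → k ⊕ zipWith _∸_ n k ≡ n
⊕-∸ []            = refl
⊕-∸ (k≤n ∷ ks≤ns) = cong₂ _∷_ (m+[n∸m]≡n k≤n) (⊕-∸ ks≤ns)

single-0 : ∀ (i : Fin S) → single i 0 ≡ 𝟎
single-0 zero    = refl
single-0 (suc i) = cong (0 ∷_) (single-0 i)

single-+ : ∀ (i : Fin S) a b → single i a ⊕ single i b ≡ single i (a + b)
single-+ zero    a b = cong (a + b ∷_) (⊕-identityˡ 𝟎)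
single-+ (suc i) a b = cong (0 ∷_) (single-+ i a b)

-- Pushes a count vector forward along `g`. An induction can then drop the first player from the
-- source, passing to `g ∘ suc`, while the counts still refer to all `N` players.
spread : (Fin S → Fin N) → Vec ℕ S → Vec ℕ N
spread g []       = 𝟎
spread g (a ∷ as) = single (g zero) a ⊕ spread (g ∘ suc) as

spread-suc : ∀ (g : Fin S → Fin N) a → spread (suc ∘ g) a ≡ 0 ∷ spread g a
spread-suc g []       = refl
spread-suc g (a ∷ as) = cong (single (suc (g zero)) a ⊕_) (spread-suc (g ∘ suc) as)

spread-id : ∀ (a : Vec ℕ S) → spread id a ≡ a
spread-id []       = refl
spread-id (a ∷ as) = begin
  single zero a ⊕ spread suc as      ≡⟨ cong (single zero a ⊕_) (spread-suc id as) ⟩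
  (a + 0) ∷ 𝟎 ⊕ spread id as         ≡⟨ cong₂ _∷_ (+-identityʳ a) (⊕-identityˡ _) ⟩
  a ∷ spread id as                   ≡⟨ cong (a ∷_) (spread-id as) ⟩
  a ∷ as                             ∎

-- Weighted counts of assignments

χ : Fin S → Fin S → ℕ
χ i j = if does (i ≟ j) then 0 else 1

χ-≡ : ∀ (i : Fin S) → χ i i ≡ 0
χ-≡ i with i ≟ i
... | yes _  = refl
... | no i≢i = contradiction refl i≢i

χ-≢ : ∀ {i j : Fin S} → i ≢ j → χ i j ≡ 1
χ-≢ {i = i} {j} i≢j with i ≟ j
... | yes i≡j = contradiction i≡j i≢j
... | no _    = refl

-- For `f j` the count after a card of player `i` goes to `j`, the first term is the card returning
-- to its owner and the sum is the card leaving him.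
∑-split : ∀ (i : Fin S) (f : Fin S → ℕ) →
  ∑ (allFin S) f ≡ f i + ∑[ j ← allFin S ] (χ i j * f j)
∑-split {suc S} zero f = begin
  ∑ (allFin (suc S)) f
    ≡⟨ ∑-allFin-suc S f ⟩
  f zero + ∑ (allFin S) (f ∘ suc)
    ≡⟨ cong (f zero +_) (∑-cong (allFin S) (λ j → +-identityʳ (f (suc j)))) ⟨
  f zero + ∑[ j ← allFin S ] (1 * f (suc j))
    ≡⟨ cong (f zero +_) (∑-allFin-suc S (λ j → χ zero j * f j)) ⟨
  f zero + ∑[ j ← allFin (suc S) ] (χ zero j * f j) ∎
∑-split {suc S} (suc i) f = begin
  ∑ (allFin (suc S)) f
    ≡⟨ ∑-allFin-suc S f ⟩
  f zero + ∑ (allFin S) (f ∘ suc)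
    ≡⟨ cong (f zero +_) (∑-split i (f ∘ suc)) ⟩
  f zero + (f (suc i) + R)
    ≡⟨ solve 3 (λ a b c → a :+ (b :+ c) := b :+ (con 1 :* a :+ c)) refl (f zero) (f (suc i)) R ⟩
  f (suc i) + (1 * f zero + R)
    ≡⟨ cong (f (suc i) +_) (∑-allFin-suc S (λ j → χ (suc i) j * f j)) ⟨
  f (suc i) + ∑[ j ← allFin (suc S) ] (χ (suc i) j * f j) ∎
  where
  open +-*-Solver
  R : ℕ
  R = ∑[ j ← allFin S ] (χ i j * f (suc j))

-- The sums of F (v ⊕ t) over all assignments of N cards, respectively over
-- those avoiding the owners w, where t counts the cards each player receives.
free : ℕ → (Vec ℕ S → ℕ) → Vec ℕ S → ℕ
free zero    F v = F v
free (suc N) F v = ∑[ j ← allFin _ ] free N F (v ⊕ single j 1)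

avoiding : Vec (Fin S) N → (Vec ℕ S → ℕ) → Vec ℕ S → ℕ
avoiding []      F v = F v
avoiding (i ∷ w) F v = ∑[ j ← allFin _ ] (χ i j * avoiding w F (v ⊕ single j 1))

free-+ : ∀ M N (F : Vec ℕ S → ℕ) v → free (M + N) F v ≡ free M (free N F) v
free-+ zero    N F v = refl
free-+ {S} (suc M) N F v = ∑-cong (allFin S) λ j → free-+ M N F (v ⊕ single j 1)

avoiding-++ : ∀ {M} (u : Vec (Fin S) M) (w : Vec (Fin S) N) F v →
  avoiding (u ++ w) F v ≡ avoiding u (avoiding w F) v
avoiding-++ []      w F v = refl
avoiding-++ {S} (i ∷ u) w F v =
  ∑-cong (allFin S) λ j → cong (χ i j *_) (avoiding-++ u w F (v ⊕ single j 1))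

avoiding-cong : ∀ (w : Vec (Fin S) N) {F G} → (∀ v → F v ≡ G v) → ∀ v → avoiding w F v ≡ avoiding w G v
avoiding-cong []      F≗G v = F≗G v
avoiding-cong {S} (i ∷ w) F≗G v =
  ∑-cong (allFin S) λ j → cong (χ i j *_) (avoiding-cong w F≗G (v ⊕ single j 1))

-- Extra cards `u` may be credited after the deal or before it, since adding counts is commutative.
avoiding-⊕ : ∀ (w : Vec (Fin S) N) F u v → avoiding w (λ t → F (t ⊕ u)) v ≡ avoiding w F (v ⊕ u)
avoiding-⊕ []      F u v = refl
avoiding-⊕ {S} (i ∷ w) F u v = ∑-cong (allFin S) λ j → cong (χ i j *_)
  (trans (avoiding-⊕ w F u (v ⊕ single j 1)) (cong (avoiding w F) (⊕-right-comm v (single j 1) u)))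

-- Linearity of `avoiding w` in `F`: it brings the expansion for the remaining players out of the
-- deal of the first player's cards.
avoiding-∑ : ∀ (w : Vec (Fin S) N) (xs : List X) (c : X → ℕ) (F : X → Vec ℕ S → ℕ) v →
  avoiding w (λ t → ∑[ x ← xs ] (c x * F x t)) v ≡ ∑[ x ← xs ] (c x * avoiding w (F x) v)
avoiding-∑ []      xs c F v = refl
avoiding-∑ {S} (i ∷ w) xs c F v = trans
  (∑-cong (allFin S) λ j → cong (χ i j *_) (avoiding-∑ w xs c F (v ⊕ single j 1)))
  (∑-swap-weighted (allFin S) xs (χ i) c λ j x → avoiding w (F x) (v ⊕ single j 1))

-- The binomial theorem for (avoid i + receive i)ⁿ: a card of player i either
-- leaves him or returns to him, and these two operators commute.
free-binomial : ∀ (i : Fin S) n F v →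
  free n F v ≡ ∑[ k ← upTo (suc n) ] ((n C k) * avoiding (replicate k i) F (v ⊕ single i (n ∸ k)))
free-binomial i zero F v = begin
  F v                         ≡⟨ cong F (trans (cong (v ⊕_) (single-0 i)) (⊕-identityʳ v)) ⟨
  F (v ⊕ single i 0)          ≡⟨ trans (+-identityʳ _) (+-identityʳ _) ⟨
  F (v ⊕ single i 0) + 0 + 0  ∎
free-binomial {S} i (suc n) F v = begin
  free (suc n) F v
    ≡⟨ ∑-split i (λ j → free n F (v ⊕ single j 1)) ⟩
  free n F (v ⊕ single i 1) + ∑[ j ← allFin S ] (χ i j * free n F (v ⊕ single j 1))
    ≡⟨ cong₂ _+_ returned left ⟩
  ∑[ k ← upTo (suc n) ] ((n C k) * g k) + ∑[ k ← upTo (suc n) ] ((n C k) * g (suc k))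
    ≡⟨ ∑-+ (upTo (suc n)) (λ k → (n C k) * g k) (λ k → (n C k) * g (suc k)) ⟨
  ∑[ k ← upTo (suc n) ] ((n C k) * g k + (n C k) * g (suc k))
    ≡⟨ ∑-cong (upTo (suc n)) (λ k → *-distribˡ-+ (n C k) (g k) (g (suc k))) ⟨
  ∑[ k ← upTo (suc n) ] ((n C k) * (g k + g (suc k)))
    ≡⟨ ∑-pascal n g ⟨
  ∑[ k ← upTo (suc (suc n)) ] ((suc n C k) * g k) ∎
  where
  g : ℕ → ℕ
  g k = avoiding (replicate k i) F (v ⊕ single i (suc n ∸ k))

  -- Membership supplies k ≤ n, without which `suc n ∸ k` need not be one more than `n ∸ k`.
  shift : ∀ {k} → k ∈ upTo (suc n) → v ⊕ single i 1 ⊕ single i (n ∸ k) ≡ v ⊕ single i (suc n ∸ k)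
  shift {k} k∈ = begin
    v ⊕ single i 1 ⊕ single i (n ∸ k)   ≡⟨ ⊕-assoc v _ _ ⟩
    v ⊕ (single i 1 ⊕ single i (n ∸ k)) ≡⟨ cong (v ⊕_) (single-+ i 1 (n ∸ k)) ⟩
    v ⊕ single i (1 + (n ∸ k))          ≡⟨ cong (λ a → v ⊕ single i a) (+-∸-assoc 1 (s≤s⁻¹ (∈-upTo⁻ k∈))) ⟨
    v ⊕ single i (suc n ∸ k)            ∎

  returned : free n F (v ⊕ single i 1) ≡ ∑[ k ← upTo (suc n) ] ((n C k) * g k)
  returned = trans (free-binomial i n F (v ⊕ single i 1)) (∑-cong-∈ (upTo (suc n)) λ {k} k∈ →
    cong (λ u → (n C k) * avoiding (replicate k i) F u) (shift k∈))

  left : ∑[ j ← allFin S ] (χ i j * free n F (v ⊕ single j 1))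
           ≡ ∑[ k ← upTo (suc n) ] ((n C k) * g (suc k))
  left = begin
    ∑[ j ← allFin S ] (χ i j * free n F (v ⊕ single j 1))
      ≡⟨ ∑-cong (allFin S) (λ j → cong (χ i j *_) (free-binomial i n F (v ⊕ single j 1))) ⟩
    ∑[ j ← allFin S ] (χ i j * ∑[ k ← upTo (suc n) ]
      ((n C k) * avoiding (replicate k i) F (v ⊕ single j 1 ⊕ single i (n ∸ k))))
      ≡⟨ ∑-swap-weighted (allFin S) (upTo (suc n)) (χ i) (n C_)
           (λ j k → avoiding (replicate k i) F (v ⊕ single j 1 ⊕ single i (n ∸ k))) ⟩
    ∑[ k ← upTo (suc n) ] ((n C k) * ∑[ j ← allFin S ]
      (χ i j * avoiding (replicate k i) F (v ⊕ single j 1 ⊕ single i (n ∸ k))))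
      ≡⟨ ∑-cong (upTo (suc n)) (λ k → cong ((n C k) *_) (∑-cong (allFin S) λ j →
           cong (λ u → χ i j * avoiding (replicate k i) F u) (⊕-right-comm v (single j 1) (single i (n ∸ k))))) ⟩
    ∑[ k ← upTo (suc n) ] ((n C k) * g (suc k)) ∎

map-owners-∷ : ∀ (g : Fin (suc S) → Fin N) k (ks : Vec ℕ S) →
  map g (owners (k ∷ ks)) ≡ replicate k (g zero) ++ map (g ∘ suc) (owners ks)
map-owners-∷ g k ks = trans (map-++ g (replicate k zero) _)
  (cong₂ _++_ (map-replicate g zero k) (sym (map-∘ g suc (owners ks))))

-- Applies `free-binomial` to one player's cards at a time. In each summand `owners k` lists the
-- cards that leave their owners, and the `spread` term credits the returned ones. A general `g` is
-- needed because the induction passes to `g ∘ suc`.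
free-multibinomial : ∀ (g : Fin S → Fin N) (n : Vec ℕ S) F v →
  free (Vec.sum n) F v
    ≡ Σ≤ n (λ k → ∏C n k * avoiding (map g (owners k)) F (v ⊕ spread g (zipWith _∸_ n k)))
free-multibinomial g [] F v = begin
  F v                ≡⟨ cong F (⊕-identityʳ v) ⟨
  F (v ⊕ 𝟎)          ≡⟨ trans (+-identityʳ _) (+-identityʳ _) ⟨
  F (v ⊕ 𝟎) + 0 + 0  ∎
free-multibinomial g (n ∷ ns) F v = begin
  free (n + Vec.sum ns) F v
    ≡⟨ free-+ n (Vec.sum ns) F v ⟩
  free n (free (Vec.sum ns) F) v
    ≡⟨ free-binomial (g zero) n (free (Vec.sum ns) F) v ⟩
  ∑[ k ← upTo (suc n) ] ((n C k) * avoiding (replicate k (g zero)) (free (Vec.sum ns) F)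
    (v ⊕ single (g zero) (n ∸ k)))
    ≡⟨ ∑-cong (upTo (suc n)) (λ k → cong ((n C k) *_) (rest k)) ⟩
  ∑[ k ← upTo (suc n) ] ((n C k) * Σ≤ ns (λ ks → ∏C ns ks *
    avoiding (map g (owners (k ∷ ks))) F (v ⊕ spread g (zipWith _∸_ (n ∷ ns) (k ∷ ks)))))
    ≡⟨ Σ≤-∏C-∷ n ns _ ⟨
  Σ≤ (n ∷ ns) (λ k → ∏C (n ∷ ns) k *
    avoiding (map g (owners k)) F (v ⊕ spread g (zipWith _∸_ (n ∷ ns) k))) ∎
  where
  u : ℕ → Vec ℕ _
  u k = v ⊕ single (g zero) (n ∸ k)

  s : Vec ℕ _ → Vec ℕ _
  s ks = spread (g ∘ suc) (zipWith _∸_ ns ks)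

  rest : ∀ k → avoiding (replicate k (g zero)) (free (Vec.sum ns) F) (u k)
    ≡ Σ≤ ns (λ ks → ∏C ns ks *
        avoiding (map g (owners (k ∷ ks))) F (v ⊕ (single (g zero) (n ∸ k) ⊕ s ks)))
  rest k = begin
    avoiding (replicate k (g zero)) (free (Vec.sum ns) F) (u k)
      -- The induction hypothesis holds for every starting count, so it can be used after the first
      -- player's `k` leaving cards are dealt.
      ≡⟨ avoiding-cong (replicate k (g zero)) (free-multibinomial (g ∘ suc) ns F) (u k) ⟩
    avoiding (replicate k (g zero))
      (λ t → Σ≤ ns (λ ks → ∏C ns ks * avoiding (map (g ∘ suc) (owners ks)) F (t ⊕ s ks))) (u k)
      ≡⟨ avoiding-∑ (replicate k (g zero)) (tuples (map (upTo ∘ suc) ns)) (∏C ns) _ (u k) ⟩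
    Σ≤ ns (λ ks → ∏C ns ks * avoiding (replicate k (g zero))
      (λ t → avoiding (map (g ∘ suc) (owners ks)) F (t ⊕ s ks)) (u k))
      ≡⟨ ∑-cong (tuples (map (upTo ∘ suc) ns)) (λ ks → cong (∏C ns ks *_) (begin
        avoiding (replicate k (g zero)) (λ t → avoiding (map (g ∘ suc) (owners ks)) F (t ⊕ s ks)) (u k)
          ≡⟨ avoiding-⊕ (replicate k (g zero)) _ (s ks) (u k) ⟩
        avoiding (replicate k (g zero)) (avoiding (map (g ∘ suc) (owners ks)) F) (u k ⊕ s ks)
          ≡⟨ avoiding-++ (replicate k (g zero)) (map (g ∘ suc) (owners ks)) F _ ⟨
        avoiding (replicate k (g zero) ++ map (g ∘ suc) (owners ks)) F (u k ⊕ s ks)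
          ≡⟨ cong₂ (λ w t → avoiding w F t) (sym (map-owners-∷ g k ks)) (⊕-assoc v _ _) ⟩
        avoiding (map g (owners (k ∷ ks))) F (v ⊕ (single (g zero) (n ∸ k) ⊕ s ks)) ∎)) ⟩
    Σ≤ ns (λ ks → ∏C ns ks *
      avoiding (map g (owners (k ∷ ks))) F (v ⊕ (single (g zero) (n ∸ k) ⊕ s ks))) ∎

-- Block derangements and multinomial coefficients as weighted counts

infix 4 _≡?_

_≡?_ : ∀ (u v : Vec ℕ S) → Dec (u ≡ v)
_≡?_ = ≡-dec ℕ._≟_

-- Taken as `F`, this turns `free` and `avoiding` into numbers of assignments that end with the
-- counts `n`.
δ : Vec ℕ S → Vec ℕ S → ℕ
δ n v = if does (v ≡? n) then 1 else 0

δ-refl : ∀ (n : Vec ℕ S) → δ n n ≡ 1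
δ-refl n with n ≡? n
... | yes _  = refl
... | no n≢n = contradiction refl n≢n

δ-≢ : ∀ (n v : Vec ℕ S) → v ≢ n → δ n v ≡ 0
δ-≢ n v v≢n with v ≡? n
... | yes v≡n = contradiction v≡n v≢n
... | no _    = refl

δ-⊕ : ∀ (n u v : Vec ℕ S) → δ (n ⊕ u) (v ⊕ u) ≡ δ n v
δ-⊕ n u v with v ≡? n
... | yes refl = δ-refl (n ⊕ u)
... | no v≢n   = δ-≢ (n ⊕ u) (v ⊕ u) (v≢n ∘ ⊕-cancelʳ u v n)

tally : Vec (Fin S) N → Vec ℕ S
tally []      = 𝟎
tally (j ∷ d) = single j 1 ⊕ tally d

lookup-tally : ∀ (d : Vec (Fin S) N) i → lookup (tally d) i ≡ count (_≟ i) d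
lookup-tally []      i = lookup-replicate i 0
lookup-tally (j ∷ d) i = begin
  lookup (single j 1 ⊕ tally d) i           ≡⟨ lookup-zipWith _+_ i (single j 1) (tally d) ⟩
  lookup (single j 1) i + lookup (tally d) i ≡⟨ cong (lookup (single j 1) i +_) (lookup-tally d i) ⟩
  lookup (single j 1) i + count (_≟ i) d     ≡⟨ step j i (count (_≟ i) d) ⟩
  count (_≟ i) (j ∷ d)                       ∎
  where
  step : ∀ {S} (j i : Fin S) c →
    lookup (single j 1) i + c ≡ (if does (j ≟ i) then suc else id) c
  step zero    zero    c = refl
  step zero    (suc i) c = cong (_+ c) (lookup-replicate i 0)
  step (suc j) zero    c = refl
  step (suc j) (suc i) c = step j i c

lookup-injective : ∀ {u v : Vec ℕ S} → (∀ i → lookup u i ≡ lookup v i) → u ≡ v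
lookup-injective {u = []}    {[]}    eq = refl
lookup-injective {u = _ ∷ _} {_ ∷ _} eq = cong₂ _∷_ (eq zero) (lookup-injective (eq ∘ suc))

-- Generalizes `IsBlockDerangement` to an arbitrary list of owners and initial counts `v`, a form
-- that is preserved when the first card is dealt.
Completes : Vec (Fin S) N → Vec ℕ S → Vec ℕ S → Vec (Fin S) N → Set
Completes w v n d = v ⊕ tally d ≡ n × Pointwise _≢_ w d

completes? : ∀ (w : Vec (Fin S) N) v n → Decidable (Completes w v n)
completes? w v n d = v ⊕ tally d ≡? n ×-dec Pointwise.decidable (λ i j → ¬? (i ≟ j)) w d

length-filter-map : ∀ {P : Y → Set} (P? : Decidable P) (h : X → Y) xs →
  length (filter P? (List.map h xs)) ≡ length (filter (P? ∘ h) xs)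
length-filter-map P? h []       = refl
length-filter-map P? h (x ∷ xs) with does (P? (h x))
... | true  = cong suc (length-filter-map P? h xs)
... | false = length-filter-map P? h xs

length-filter-cartesianProductWith : ∀ {Z : Set} {P : Z → Set} (P? : Decidable P)
  (h : X → Y → Z) xs ys →
  length (filter P? (List.cartesianProductWith h xs ys))
    ≡ ∑[ x ← xs ] length (filter (P? ∘ h x) ys)
length-filter-cartesianProductWith P? h []       ys = refl
length-filter-cartesianProductWith P? h (x ∷ xs) ys = begin
  length (filter P? (List.map (h x) ys List.++ R))
    ≡⟨ cong length (filter-++ P? (List.map (h x) ys) R) ⟩
  length (filter P? (List.map (h x) ys) List.++ filter P? R)
    ≡⟨ length-++ (filter P? (List.map (h x) ys)) ⟩
  length (filter P? (List.map (h x) ys)) + length (filter P? R)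
    ≡⟨ cong₂ _+_ (length-filter-map P? (h x) ys) (length-filter-cartesianProductWith P? h xs ys) ⟩
  length (filter (P? ∘ h x) ys) + ∑[ x ← xs ] length (filter (P? ∘ h x) ys) ∎
  where
  R : List _
  R = List.cartesianProductWith h xs ys

-- Induction on the cards, sorting the assignments by the receiver `j` of the first one.
avoiding-counts : ∀ (w : Vec (Fin S) N) v n →
  length (filter (completes? w v n) (assignments S N)) ≡ avoiding w (δ n) v
avoiding-counts [] v n with v ⊕ 𝟎 ≡? n
... | yes v≡n = sym (trans (cong (δ n) (trans (sym (⊕-identityʳ v)) v≡n)) (δ-refl n))
... | no v≢n  = sym (δ-≢ n v (v≢n ∘ trans (⊕-identityʳ v)))
avoiding-counts {S} {suc N} (i ∷ w) v n = trans
  (length-filter-cartesianProductWith (completes? (i ∷ w) v n) _∷_ (allFin S) (assignments S N))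
  (∑-cong (allFin S) first)
  where
  P? : ∀ j → Decidable (Completes (i ∷ w) v n ∘ (j ∷_))
  P? j d = completes? (i ∷ w) v n (j ∷ d)

  first-≡ : ∀ {j} → i ≡ j → length (filter (P? j) (assignments S N))
              ≡ χ i j * avoiding w (δ n) (v ⊕ single j 1)
  first-≡ refl = begin
    length (filter (P? i) (assignments S N))
      -- The first card is back with its owner, so no assignment qualifies.
      ≡⟨ cong length (filter-none (P? i) {assignments S N}
           (ListAll.universal (λ { d (_ , i≢i ∷ _) → i≢i refl }) _)) ⟩
    0
      ≡⟨ cong (_* avoiding w (δ n) (v ⊕ single i 1)) (χ-≡ i) ⟨
    χ i i * avoiding w (δ n) (v ⊕ single i 1) ∎

  first-≢ : ∀ {j} → i ≢ j → length (filter (P? j) (assignments S N))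
              ≡ χ i j * avoiding w (δ n) (v ⊕ single j 1)
  first-≢ {j} i≢j = begin
    length (filter (P? j) (assignments S N))
      -- By associativity the first card moves from the tally into the initial counts.
      ≡⟨ cong length (filter-≐ (P? j) (completes? w (v ⊕ single j 1) n)
           ( (λ { {d} (eq , _ ∷ w≢d) → trans (⊕-assoc v _ (tally d)) eq , w≢d })
           , (λ { {d} (eq , w≢d) → trans (sym (⊕-assoc v _ (tally d))) eq , i≢j ∷ w≢d }))
           (assignments S N)) ⟩
    length (filter (completes? w (v ⊕ single j 1) n) (assignments S N))
      ≡⟨ avoiding-counts w (v ⊕ single j 1) n ⟩
    avoiding w (δ n) (v ⊕ single j 1)
      ≡⟨ +-identityʳ _ ⟨
    1 * avoiding w (δ n) (v ⊕ single j 1)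
      ≡⟨ cong (_* avoiding w (δ n) (v ⊕ single j 1)) (χ-≢ i≢j) ⟨
    χ i j * avoiding w (δ n) (v ⊕ single j 1) ∎

  first : ∀ j → length (filter (P? j) (assignments S N))
            ≡ χ i j * avoiding w (δ n) (v ⊕ single j 1)
  first j = [ first-≡ , first-≢ ]′ (toSum (i ≟ j))

E≡avoiding : ∀ (n : Vec ℕ S) → E n ≡ avoiding (owners n) (δ n) 𝟎
E≡avoiding {S} n = trans
  (cong length (filter-≐ (isBlockDerangement? n) (completes? (owners n) 𝟎 n)
    ( (λ { {d} (deal , w≢d) →
           trans (⊕-identityˡ (tally d)) (lookup-injective λ i → trans (lookup-tally d i) (deal i)) , w≢d })
    , (λ { {d} (eq , w≢d) →
           (λ i → trans (sym (lookup-tally d i))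
                        (cong (λ t → lookup t i) (trans (sym (⊕-identityˡ (tally d))) eq))) , w≢d }))
    (assignments S (Vec.sum n))))
  (avoiding-counts (owners n) 𝟎 n)

-- Counts never decrease during a deal, so a target already exceeded at `i` cannot be reached.
free-δ-excess : ∀ N (n v : Vec ℕ S) i → lookup n i < lookup v i → free N (δ n) v ≡ 0
free-δ-excess zero n v i n<v = δ-≢ n v λ { refl → <-irrefl refl n<v }
free-δ-excess {S} (suc N) n v i n<v = trans
  (∑-cong (allFin S) λ j → free-δ-excess N n (v ⊕ single j 1) i
    (<-≤-trans n<v (subst (lookup v i ≤_) (sym (lookup-zipWith _+_ i v (single j 1))) (m≤m+n _ _))))
  (∑-zero (allFin S))

∏! : Vec ℕ S → ℕ
∏! u = prod (map _! u)

-- Prepares the recursion on the receiver of the first card: either `j` may take no card, or one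
-- unit is removed and the product of factorials loses the factor uⱼ.
remove-one : ∀ (u : Vec ℕ S) j → lookup u j ≡ 0 ⊎
  ∃ λ u′ → u ≡ single j 1 ⊕ u′ × Vec.sum u ≡ suc (Vec.sum u′) × ∏! u ≡ lookup u j * ∏! u′
remove-one (zero ∷ u)  zero = inj₁ refl
remove-one (suc a ∷ u) zero =
  inj₂ (a ∷ u , cong (suc a ∷_) (sym (⊕-identityˡ u)) , refl , *-assoc (suc a) (a !) (∏! u))
remove-one (a ∷ u) (suc j) with remove-one u j
... | inj₁ uj≡0 = inj₁ uj≡0
... | inj₂ (u′ , eq , sum-eq , ∏-eq) = inj₂ (a ∷ u′ , cong (a ∷_) eq
      , trans (cong (a +_) sum-eq) (+-suc a _)
      , trans (cong (a ! *_) ∏-eq) (a*[b*c]≡b*[a*c] (a !) (lookup u j) (∏! u′)))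

∑-lookup : ∀ (u : Vec ℕ S) → ∑ (allFin S) (lookup u) ≡ Vec.sum u
∑-lookup []              = refl
∑-lookup {suc S} (a ∷ u) = trans (∑-allFin-suc S (lookup (a ∷ u))) (cong (a +_) (∑-lookup u))

sum≡0⇒≡𝟎 : ∀ (u : Vec ℕ S) → Vec.sum u ≡ 0 → u ≡ 𝟎
sum≡0⇒≡𝟎 []         _  = refl
sum≡0⇒≡𝟎 (zero ∷ u) eq = cong (0 ∷_) (sum≡0⇒≡𝟎 u eq)

∏!-𝟎 : ∀ S → ∏! (𝟎 {S}) ≡ 1
∏!-𝟎 zero    = refl
∏!-𝟎 (suc S) = trans (+-identityʳ _) (∏!-𝟎 S)

-- If the first card goes to `j`, the remaining deals times `∏! u` give uⱼ · N!, and the uⱼ add up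
-- to N + 1. Multiplying by the factorials keeps division out of the induction.
free-δ-∏! : ∀ N (u v : Vec ℕ S) → Vec.sum u ≡ N → free N (δ (v ⊕ u)) v * ∏! u ≡ N !
free-δ-∏! {S} zero u v sum≡ with refl ← sum≡0⇒≡𝟎 u sum≡ = begin
  δ (v ⊕ 𝟎) v * ∏! (𝟎 {S})  ≡⟨ cong₂ (λ t p → δ t v * p) (⊕-identityʳ v) (∏!-𝟎 S) ⟩
  δ v v * 1                 ≡⟨ cong (_* 1) (δ-refl v) ⟩
  1                         ∎
free-δ-∏! {S} (suc N) u v sum≡ = begin
  ∑[ j ← allFin S ] free N (δ (v ⊕ u)) (v ⊕ single j 1) * ∏! u
    ≡⟨ ∑-*ʳ (allFin S) (∏! u) _ ⟩
  ∑[ j ← allFin S ] (free N (δ (v ⊕ u)) (v ⊕ single j 1) * ∏! u)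
    ≡⟨ ∑-cong (allFin S) first ⟩
  ∑[ j ← allFin S ] (lookup u j * N !)
    ≡⟨ ∑-*ʳ (allFin S) (N !) (lookup u) ⟨
  ∑ (allFin S) (lookup u) * N !
    ≡⟨ cong (_* N !) (trans (∑-lookup u) sum≡) ⟩
  suc N * N ! ∎
  where
  first : ∀ j → free N (δ (v ⊕ u)) (v ⊕ single j 1) * ∏! u ≡ lookup u j * N !
  first j with remove-one u j
  -- Player `j` is already at the target, so this card exceeds it and both sides are 0.
  ... | inj₁ uj≡0 = begin
    free N (δ (v ⊕ u)) (v ⊕ single j 1) * ∏! u
      ≡⟨ cong (_* ∏! u) (free-δ-excess N (v ⊕ u) (v ⊕ single j 1) j exceeds) ⟩
    0
      ≡⟨ cong (_* N !) uj≡0 ⟨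
    lookup u j * N ! ∎
    where
    lookup-single : ∀ {S} (j : Fin S) → lookup (single j 1) j ≡ 1
    lookup-single zero    = refl
    lookup-single (suc j) = lookup-single j
    exceeds : lookup (v ⊕ u) j < lookup (v ⊕ single j 1) j
    exceeds = subst₂ _<_
      (sym (trans (lookup-zipWith _+_ j v u) (cong (lookup v j +_) uj≡0)))
      (sym (trans (lookup-zipWith _+_ j v (single j 1)) (cong (lookup v j +_) (lookup-single j))))
      (+-monoʳ-< (lookup v j) (n<1+n 0))
  ... | inj₂ (u′ , eq , sum-eq , ∏-eq) = begin
    free N (δ (v ⊕ u)) (v ⊕ single j 1) * ∏! u
      ≡⟨ cong₂ (λ t p → free N (δ t) (v ⊕ single j 1) * p)
           (trans (cong (v ⊕_) eq) (sym (⊕-assoc v _ u′))) ∏-eq ⟩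
    free N (δ (v ⊕ single j 1 ⊕ u′)) (v ⊕ single j 1) * (lookup u j * ∏! u′)
      ≡⟨ a*[b*c]≡b*[a*c] (free N (δ (v ⊕ single j 1 ⊕ u′)) (v ⊕ single j 1)) (lookup u j) (∏! u′) ⟩
    lookup u j * (free N (δ (v ⊕ single j 1 ⊕ u′)) (v ⊕ single j 1) * ∏! u′)
      ≡⟨ cong (lookup u j *_) (free-δ-∏! N u′ (v ⊕ single j 1) (suc-injective (trans (sym sum-eq) sum≡))) ⟩
    lookup u j * N ! ∎

-- From multinomial coefficients to block derangements

multinomial≡free : ∀ (l : Vec ℕ S) → multinomial l ≡ free (Vec.sum l) (δ l) 𝟎
multinomial≡free l = begin
  multinomial l
    ≡⟨ cong (λ a → (a ℕ./ ∏! l) {{prod!≢0 l}}) (free-δ-∏! (Vec.sum l) l 𝟎 refl) ⟨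
  (free (Vec.sum l) (δ (𝟎 ⊕ l)) 𝟎 * ∏! l ℕ./ ∏! l) {{prod!≢0 l}}
    ≡⟨ m*n/n≡m _ (∏! l) {{prod!≢0 l}} ⟩
  free (Vec.sum l) (δ (𝟎 ⊕ l)) 𝟎
    ≡⟨ cong (λ t → free (Vec.sum l) (δ t) 𝟎) (⊕-identityˡ l) ⟩
  free (Vec.sum l) (δ l) 𝟎 ∎

-- Here kⱼ is the number of cards leaving player `j`, and `∏C l k` chooses which ones; redealing
-- them is a block derangement.
multinomial-by-fixed-cards : ∀ (l : Vec ℕ S) → multinomial l ≡ Σ≤ l (λ k → ∏C l k * E k)
multinomial-by-fixed-cards l = begin
  multinomial l
    ≡⟨ multinomial≡free l ⟩
  free (Vec.sum l) (δ l) 𝟎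
    ≡⟨ free-multibinomial id l (δ l) 𝟎 ⟩
  Σ≤ l (λ k → ∏C l k * avoiding (map id (owners k)) (δ l) (𝟎 ⊕ spread id (zipWith _∸_ l k)))
    ≡⟨ Σ≤-cong l (λ {k} k≤l → cong (∏C l k *_) (derangements k k≤l)) ⟩
  Σ≤ l (λ k → ∏C l k * E k) ∎
  where
  derangements : ∀ k → Pointwise _≤_ k l →
    avoiding (map id (owners k)) (δ l) (𝟎 ⊕ spread id (zipWith _∸_ l k)) ≡ E k
  derangements k k≤l = begin
    avoiding (map id (owners k)) (δ l) (𝟎 ⊕ spread id u)
      ≡⟨ cong₂ (λ w t → avoiding w (δ l) (𝟎 ⊕ t)) (map-id (owners k)) (spread-id u) ⟩
    avoiding (owners k) (δ l) (𝟎 ⊕ u)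
      -- Writing the target as `k ⊕ u` exposes the returned cards `u` in both the target and the
      -- initial counts, where `δ-⊕` then cancels them.
      ≡⟨ cong (λ t → avoiding (owners k) (δ t) (𝟎 ⊕ u)) (⊕-∸ k≤l) ⟨
    avoiding (owners k) (δ (k ⊕ u)) (𝟎 ⊕ u)
      ≡⟨ avoiding-⊕ (owners k) (δ (k ⊕ u)) u 𝟎 ⟨
    avoiding (owners k) (λ t → δ (k ⊕ u) (t ⊕ u)) 𝟎
      ≡⟨ avoiding-cong (owners k) (δ-⊕ k u) 𝟎 ⟩
    avoiding (owners k) (δ k) 𝟎
      ≡⟨ E≡avoiding k ⟨
    E k ∎
    where
    u : Vec ℕ _
    u = zipWith _∸_ l k

mainTheorem10 : ∀ {S : ℕ} (m : Vec ℕ S) → All (0 <_) m →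
    B m ≡ Σ-over (map upTo m) multinomial
mainTheorem10 m _ = begin
  B m
    ≡⟨ cong (λ r → Σ-over r (λ k → ∏C m k * E (map pred k))) (map-∘ (List.map suc) upTo m) ⟩
  Σ-over (map (List.map suc) (map upTo m)) (λ k → ∏C m k * E (map pred k))
    ≡⟨ Σ-over-map suc (map upTo m) _ ⟩
  Σ-over (map upTo m) (λ k → ∏C m (map suc k) * E (map pred (map suc k)))
    -- After the shift of the index, `pred` is applied only to successors and cancels.
    ≡⟨ ∑-cong (tuples (map upTo m)) (λ k → cong (λ k′ → ∏C m (map suc k) * E k′)
         (trans (sym (map-∘ pred suc k)) (map-id k))) ⟩
  Σ-over (map upTo m) (λ k → ∏C m (map suc k) * E k)
    ≡⟨ ∏-hockey-stick m E ⟨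
  Σ-over (map upTo m) (λ l → Σ≤ l (λ k → ∏C l k * E k))
    ≡⟨ ∑-cong (tuples (map upTo m)) multinomial-by-fixed-cards ⟨
  Σ-over (map upTo m) multinomial ∎
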